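{- Let $\lambda\in\mathbb{R}\setminus\{0\}$, $k\in\mathbb{Z}$, $u\in\mathbb{C}$ with $u\neq 1$, and $x\in\mathbb{R}$. Then for every integer $n\geq 0$, \[ FG_{n,\lambda}^{(k)}(x,u)=n\sum_{m=0}^{n-1}\frac{\binom{n-1}{m}}{m+1}\sum_{j=1}^{m+1}\frac{(1)_{j,\lambda}}{j^{k-1}}S_{1,\lambda}(m+1,j)\,FG_{n-1-m,\lambda}(x,u), \] where $FG_{l,\lambda}(x,u)$ are defined by $\frac{1-u}{e_\lambda(t)-u}e_\lambda^{x}(t)=\sum_{l\ge 0}FG_{l,\lambda}(x,u)\frac{t^l}{l!}$.
   Context: All generating functions are formal power series in $t$. For $z\in\mathbb{C}$: $(z)_{0,\lambda}=1$ and $(z)_{n,\lambda}=z(z-\lambda)(z-2\lambda)\cdots(z-(n-1)\lambda)$ for $n\ge1$. The degenerate exponential is $e_\lambda^{z}(t)=(1+\lambda t)^{z/\lambda}=\sum_{n\ge0}(z)_{n,\lambda}\frac{t^n}{n!}$, and $e_\lambda(t)=e_\lambda^{1}(t)$. Its compositional inverse is $\log_\lambda(1+t)=\frac{1}{\lambda}\big((1+t)^\lambda-1\big)$. The degenerate Stirling numbers of the first kind are defined by $\frac{1}{j!}(\log_\lambda(1+t))^j=\sum_{n\ge j}S_{1,\lambda}(n,j)\frac{t^n}{n!}$. The modified degenerate polyexponential function is $\mathrm{Ei}_{k,\lambda}(x)=\sum_{n\ge1}\frac{(1)_{n,\lambda}}{n^k(n-1)!}x^n$. The degenerate poly-Frobenius-Genocchi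 polynomials are defined by $\sum_{n\ge0}FG_{n,\lambda}^{(k)}(x,u)\frac{t^n}{n!}=\frac{(1-u)\,\mathrm{Ei}_{k,\lambda}(\log_\lambda(1+t))}{e_\lambda(t)-u}e_\lambda^{x}(t)$. -}

module Defs where

open import Level using (0ℓ; _⊔_)
open import Function.Base using (_∘′_)
open import Data.Empty using (⊥-elim)
open import Data.Nat.Base as ℕ using (ℕ; zero; suc; _∸_; _!)
import Data.Nat.Properties as ℕ
open import Data.Integer.Base using (ℤ; +_; -[1+_])
open import Data.Fin.Base using (Fin; zero; suc; toℕ)
open import Data.Vec.Functional as Vector using (Vector; _∷_)
open import Data.Product.Base using (_×_; _,_; proj₁; proj₂; ∃-syntax)
open import Data.Sum.Base as Sum using (_⊎_; inj₁; inj₂)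
open import Relation.Nullary using (¬_; Dec; yes; no)
open import Relation.Binary.Structures using (IsEquivalence)
import Relation.Binary.PropositionalEquality as ≡
open import Algebra.Apartness.Bundles using (HeytingField; module HeytingCommutativeRing)
open import Algebra.Bundles using (CommutativeRing; Monoid)
import Algebra.Apartness.Properties.HeytingCommutativeRing as HeytingProperties
import Algebra.Definitions as AlgebraicDefinitions
import Algebra.Definitions.RawMonoid as RawMonoidDefinitions
import Algebra.Properties.Ring as RingProperties
import Algebra.Properties.Semiring.Sum as SemiringSum
import Algebra.Structures as AlgebraicStructures
import Relation.Binary.Reasoning.Setoid as SetoidReasoning

fieldRing : ∀ {c ℓ₁ ℓ₂} → HeytingField c ℓ₁ ℓ₂ → CommutativeRing c ℓ₁
fieldRing K = HeytingCommutativeRing.commutativeRing (HeytingField.heytingCommutativeRing K)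

natural : ∀ {c ℓ₁ ℓ₂} (K : HeytingField c ℓ₁ ℓ₂) → ℕ → HeytingField.Carrier K
natural K n = n · HeytingField.1# K
  where
  open RawMonoidDefinitions (Monoid.rawMonoid (CommutativeRing.+-monoid (fieldRing K)))
    using () renaming (_×_ to _·_)

CharacteristicZero : ∀ {c ℓ₁ ℓ₂} → HeytingField c ℓ₁ ℓ₂ → Set ℓ₂
CharacteristicZero K = ∀ n → natural K (suc n) # 0#
  where open HeytingField K

SumOfSquares#0 : ∀ {c ℓ₁ ℓ₂} → HeytingField c ℓ₁ ℓ₂ → Set (c ⊔ ℓ₂)
SumOfSquares#0 F = ∀ x y → x # 0# → x * x + y * y # 0#
  where open HeytingField F

module Real where

  open import Relation.Binary.PropositionalEquality using (_≡_; _≢_; refl; sym; trans; cong; cong₂; subst)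
  open import Data.Rational
  open import Data.Rational.Properties hiding (#⇒invertible; invertible⇒#; heytingField)
  open import Data.Rational.Solver using (module +-*-Solver)
  open +-*-Solver

  infix 4 _~_ _≈_ _#_

  -- x m − y n → 0 as m, n → ∞.  On the diagonal this is the Cauchy condition;
  -- between Cauchy sequences it says that they have the same limit.
  _~_ : (ℕ → ℚ) → (ℕ → ℚ) → Set
  x ~ y = ∀ ε → 0ℚ < ε → ∃[ N ] (∀ m n → N ℕ.≤ m → N ℕ.≤ n → ∣ x m - y n ∣ ≤ ε)

  record ℝ : Set where
    constructor mkℝ
    field
      seq    : ℕ → ℚ
      cauchy : seq ~ seq
  open ℝ public

  _≈_ : ℝ → ℝ → Set
  x ≈ y = seq x ~ seq y

  -- Bounded away from each other: the constructive x ≠ y, which is what division needs.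
  _#_ : ℝ → ℝ → Set
  x # y = ∃[ ε ] (0ℚ < ε × ∃[ N ] (∀ n → N ℕ.≤ n → ε ≤ ∣ seq x n - seq y n ∣))

  private
    *-pos : ∀ {p q} → 0ℚ < p → 0ℚ < q → 0ℚ < p * q
    *-pos {p} {q} 0<p 0<q = positive⁻¹ (p * q) {{pos*pos⇒pos p {{positive 0<p}} q {{positive 0<q}}}}

    1/-pos : ∀ {p} (0<p : 0ℚ < p) → 0ℚ < (1/ p) {{>-nonZero 0<p}}
    1/-pos {p} 0<p = positive⁻¹ _ {{1/pos⇒pos p {{positive 0<p}}}}

    *-monoˡ : ∀ {r p q} → 0ℚ ≤ r → p ≤ q → r * p ≤ r * q
    *-monoˡ {r} 0≤r = *-monoˡ-≤-nonNeg r {{nonNegative 0≤r}}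

    *-mono : ∀ {p q r s} → 0ℚ ≤ p → 0ℚ ≤ s → p ≤ q → r ≤ s → p * r ≤ q * s
    *-mono {p} {q} {r} {s} 0≤p 0≤s p≤q r≤s =
      ≤-trans (*-monoˡ 0≤p r≤s) (*-monoʳ-≤-nonNeg s {{nonNegative 0≤s}} p≤q)

    mul-diff : ∀ a b c d → a * b - c * d ≡ a * (b - d) + d * (a - c)
    mul-diff = solve 4 (λ a b c d → a :* b :+ :- (c :* d)
      := a :* (b :+ :- d) :+ d :* (a :+ :- c)) refl

    add-diff : ∀ a b c d → (a - c) + (b - d) ≡ (a + b) - (c + d)
    add-diff = solve 4 (λ a b c d → (a :+ :- c) :+ (b :+ :- d) := (a :+ b) :+ :- (c :+ d)) refl

    diff-add : ∀ a b → (a - b) + b ≡ a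
    diff-add = solve 2 (λ a b → (a :+ :- b) :+ b := a) refl

    neg-diff : ∀ a b → - (a - b) ≡ - a - - b
    neg-diff = solve 2 (λ a b → :- (a :+ :- b) := :- a :+ :- (:- b)) refl

    swap-diff : ∀ a b → - (a - b) ≡ b - a
    swap-diff = solve 2 (λ a b → :- (a :+ :- b) := b :+ :- a) refl

    tri-diff : ∀ p q r → (p - q) + (q - r) ≡ p - r
    tri-diff = solve 3 (λ p q r → (p :+ :- q) :+ (q :+ :- r) := p :+ :- r) refl

    recip-diff : ∀ a b p q → a * b * (q - p) ≡ a * (b * q) - b * (a * p)
    recip-diff = solve 4 (λ a b p q → a :* b :* (q :+ :- p) := a :* (b :* q) :+ :- (b :* (a :* p))) refl

    cancel-eqˡ : ∀ δ → (δ + δ + δ) + (- δ - δ) ≡ δ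
    cancel-eqˡ = solve 1 (λ δ → (δ :+ δ :+ δ) :+ (:- δ :+ :- δ) := δ) refl

    cancel-eqʳ : ∀ δ D → (δ + (D + δ)) + (- δ - δ) ≡ D
    cancel-eqʳ = solve 2 (λ δ D → (δ :+ (D :+ δ)) :+ (:- δ :+ :- δ) := D) refl

    triangle : ∀ p q r → ∣ p - r ∣ ≤ ∣ p - q ∣ + ∣ q - r ∣
    triangle p q r = subst (λ t → ∣ t ∣ ≤ ∣ p - q ∣ + ∣ q - r ∣)
      (tri-diff p q r)
      (∣p+q∣≤∣p∣+∣q∣ (p - q) (q - r))

    flip-∣∣ : ∀ p q → ∣ p - q ∣ ≡ ∣ q - p ∣
    flip-∣∣ p q = trans (sym (∣-p∣≡∣p∣ (p - q)))
      (cong ∣_∣ (swap-diff p q))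

    0≤1 : 0ℚ ≤ 1ℚ
    0≤1 = nonNegative⁻¹ 1ℚ

    0<1 : 0ℚ < 1ℚ
    0<1 = positive⁻¹ 1ℚ

    0<½ : 0ℚ < ½
    0<½ = positive⁻¹ ½

    half< : ∀ {ε} → 0ℚ < ε → ½ * ε < ε
    half< {ε} 0<ε = subst (½ * ε <_) (*-identityˡ ε)
      (*-monoˡ-<-pos ε {{positive 0<ε}} (+-monoʳ-< ½ 0<½))

    sixth five : ℚ
    sixth = + 1 / 6
    five = + 5 / 1

    six-eq : ∀ ε → (sixth * ε + sixth * ε + sixth * ε) + (sixth * ε + sixth * ε + sixth * ε) ≡ ε
    six-eq = solve 1 (λ ε → let s = con sixth :* ε in (s :+ s :+ s) :+ (s :+ s :+ s) := ε) refl

    five-eq : ∀ δ → δ + ((δ + δ + δ) + δ) ≡ five * δ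
    five-eq = solve 1 (λ δ → δ :+ ((δ :+ δ :+ δ) :+ δ) := con five :* δ) refl

  ~-scale : ∀ {x y} B → 0ℚ < B →
    (∀ ε → 0ℚ < ε → ∃[ N ] (∀ m n → N ℕ.≤ m → N ℕ.≤ n → ∣ x m - y n ∣ ≤ B * ε)) → x ~ y
  ~-scale {x} {y} B 0<B h ε 0<ε = let N , p = h ε′ 0<ε′ in
    N , λ m n N≤m N≤n → subst (∣ x m - y n ∣ ≤_) eq (p m n N≤m N≤n)
    where
    instance _ = >-nonZero 0<B
    ε′ = 1/ B * ε
    0<ε′ = *-pos (1/-pos 0<B) 0<ε
    eq : B * ε′ ≡ ε
    eq = trans (sym (*-assoc B (1/ B) ε)) (trans (cong (_* ε) (*-inverseʳ B)) (*-identityˡ ε))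

  private
    infixl 6 _⊔ₙ_
    _⊔ₙ_ = ℕ._⊔_
    ⊔ˡ : ∀ {M N n} → M ⊔ₙ N ℕ.≤ n → M ℕ.≤ n
    ⊔ˡ {M} {N} = ℕ.≤-trans (ℕ.m≤m⊔n M N)
    ⊔ʳ : ∀ {M N n} → M ⊔ₙ N ℕ.≤ n → N ℕ.≤ n
    ⊔ʳ {M} {N} = ℕ.≤-trans (ℕ.m≤n⊔m M N)

    two : ℚ
    two = 1ℚ + 1ℚ
    0<two : 0ℚ < two
    0<two = positive⁻¹ two
    twice : ∀ ε → ε + ε ≡ two * ε
    twice = solve 1 (λ ε → ε :+ ε := (con 1ℚ :+ con 1ℚ) :* ε) refl

  ~-sym : ∀ {x y} → x ~ y → y ~ x
  ~-sym {x} {y} p ε 0<ε = let N , q = p ε 0<ε in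
    N , λ m n N≤m N≤n → subst (_≤ ε) (flip-∣∣ (x n) (y m)) (q n m N≤n N≤m)

  ~-trans : ∀ {x y z} → x ~ y → y ~ z → x ~ z
  ~-trans {x} {y} {z} p q = ~-scale {x} {z} two 0<two λ ε 0<ε →
    let M , p′ = p ε 0<ε
        N , q′ = q ε 0<ε
        K = M ⊔ₙ N
    in K , λ m n K≤m K≤n →
      subst (∣ x m - z n ∣ ≤_) (twice ε)
        (≤-trans (triangle (x m) (y K) (z n))
          (+-mono-≤ (p′ m K (⊔ˡ K≤m) (ℕ.m≤m⊔n M N)) (q′ K n (ℕ.m≤n⊔m M N) (⊔ʳ {M} K≤n))))

  ~-reflˡ : ∀ {x y} → x ~ y → x ~ x
  ~-reflˡ {x} {y} p = ~-trans {x} {y} {x} p (~-sym {x} {y} p)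

  ~-eventually : ∀ {x y} → x ~ x → ∃[ N ] (∀ n → N ℕ.≤ n → x n ≡ y n) → x ~ y
  ~-eventually {x} {y} p (M , e) ε 0<ε = let N , q = p ε 0<ε in
    M ⊔ₙ N , λ m n K≤m K≤n →
      subst (λ t → ∣ x m - t ∣ ≤ ε) (e n (⊔ˡ K≤n)) (q m n (⊔ʳ {M} K≤m) (⊔ʳ {M} K≤n))

  ~-pointwise : ∀ {x y} → x ~ x → (∀ n → x n ≡ y n) → x ~ y
  ~-pointwise {x} {y} p e = ~-eventually {x} {y} p (0 , λ n _ → e n)

  Bounded : (ℕ → ℚ) → Set
  Bounded x = ∃[ B ] (0ℚ < B × ∃[ N ] (∀ n → N ℕ.≤ n → ∣ x n ∣ ≤ B))

  bounded : ∀ {x} → x ~ x → Bounded x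
  bounded {x} p with p 1ℚ 0<1
  ... | N , q = 1ℚ + ∣ x N ∣
    , <-≤-trans 0<1 (subst (_≤ 1ℚ + ∣ x N ∣) (+-identityʳ 1ℚ) (+-monoʳ-≤ 1ℚ (0≤∣p∣ (x N))))
    , N , λ n N≤n →
      ≤-trans (subst (λ t → ∣ t ∣ ≤ ∣ x n - x N ∣ + ∣ x N ∣)
                (diff-add (x n) (x N))
                (∣p+q∣≤∣p∣+∣q∣ (x n - x N) (x N)))
        (+-monoˡ-≤ ∣ x N ∣ (q n N N≤n ℕ.≤-refl))

  +-~ : ∀ {x x′ y y′} → x ~ x′ → y ~ y′ → (λ n → x n + y n) ~ (λ n → x′ n + y′ n)
  +-~ {x} {x′} {y} {y′} p q = ~-scale {λ n → x n + y n} {λ n → x′ n + y′ n} two 0<two λ ε 0<ε →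
    let M , p′ = p ε 0<ε
        N , q′ = q ε 0<ε
    in M ⊔ₙ N , λ m n K≤m K≤n →
      subst₂≤ (add-diff (x m) (y m) (x′ n) (y′ n))
              (twice ε)
        (≤-trans (∣p+q∣≤∣p∣+∣q∣ (x m - x′ n) (y m - y′ n))
          (+-mono-≤ (p′ m n (⊔ˡ K≤m) (⊔ˡ K≤n)) (q′ m n (⊔ʳ {M} K≤m) (⊔ʳ {M} K≤n))))
    where
    subst₂≤ : ∀ {a b c d} → a ≡ b → c ≡ d → ∣ a ∣ ≤ c → ∣ b ∣ ≤ d
    subst₂≤ refl refl h = h

  neg-~ : ∀ {x y} → x ~ y → (λ n → - x n) ~ (λ n → - y n)
  neg-~ {x} {y} p ε 0<ε = let N , q = p ε 0<ε in
    N , λ m n N≤m N≤n → subst (_≤ ε) (eq m n) (q m n N≤m N≤n)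
    where
    eq : ∀ m n → ∣ x m - y n ∣ ≡ ∣ - x m - - y n ∣
    eq m n = trans (sym (∣-p∣≡∣p∣ (x m - y n)))
      (cong ∣_∣ (neg-diff (x m) (y n)))

  private
    mul-bound : ∀ a b c d {B C ε} → 0ℚ ≤ ε → ∣ a ∣ ≤ B → ∣ d ∣ ≤ C →
      ∣ a - c ∣ ≤ ε → ∣ b - d ∣ ≤ ε → ∣ a * b - c * d ∣ ≤ (B + C) * ε
    mul-bound a b c d {B} {C} {ε} 0≤ε aB dC ac bd = begin
      ∣ a * b - c * d ∣
        ≡⟨ cong ∣_∣ (mul-diff a b c d) ⟩
      ∣ a * (b - d) + d * (a - c) ∣
        ≤⟨ ∣p+q∣≤∣p∣+∣q∣ (a * (b - d)) (d * (a - c)) ⟩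
      ∣ a * (b - d) ∣ + ∣ d * (a - c) ∣
        ≡⟨ cong₂ _+_ (∣p*q∣≡∣p∣*∣q∣ a (b - d)) (∣p*q∣≡∣p∣*∣q∣ d (a - c)) ⟩
      ∣ a ∣ * ∣ b - d ∣ + ∣ d ∣ * ∣ a - c ∣
        ≤⟨ +-mono-≤ (*-mono {∣ a ∣} {B} {∣ b - d ∣} {ε} (0≤∣p∣ a) 0≤ε aB bd)
                    (*-mono {∣ d ∣} {C} {∣ a - c ∣} {ε} (0≤∣p∣ d) 0≤ε dC ac) ⟩
      B * ε + C * ε
        ≡⟨ sym (*-distribʳ-+ ε B C) ⟩
      (B + C) * ε ∎
      where open ≤-Reasoning

  *-~ : ∀ {x x′ y y′} → x ~ x′ → y ~ y′ → (λ n → x n * y n) ~ (λ n → x′ n * y′ n)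
  *-~ {x} {x′} {y} {y′} p q =
    bounded-*-~ (bounded {x} (~-reflˡ {x} {x′} p)) (bounded {y′} (~-reflˡ {y′} {y} (~-sym {y} {y′} q)))
    where
    bounded-*-~ : Bounded x → Bounded y′ → (λ n → x n * y n) ~ (λ n → x′ n * y′ n)
    bounded-*-~ (B , 0<B , K , xB) (C , 0<C , L , yC) = ~-scale {λ n → x n * y n} {λ n → x′ n * y′ n} (B + C) 0<B+C near
      where
      0<B+C : 0ℚ < B + C
      0<B+C = <-trans 0<B (subst (_< B + C) (+-identityʳ B) (+-monoʳ-< B 0<C))
      near : ∀ ε → 0ℚ < ε →
        ∃[ N ] (∀ m n → N ℕ.≤ m → N ℕ.≤ n → ∣ x m * y m - x′ n * y′ n ∣ ≤ (B + C) * ε)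
      near ε 0<ε with p ε 0<ε | q ε 0<ε
      ... | M , p′ | N , q′ = M ⊔ₙ (N ⊔ₙ (K ⊔ₙ L)) , λ m n J≤m J≤n →
        mul-bound (x m) (y m) (x′ n) (y′ n) {B} {C} {ε} (<⇒≤ 0<ε)
          (xB m (⊔ˡ {K} {L} (⊔ʳ {N} {K ⊔ₙ L} (⊔ʳ {M} J≤m))))
          (yC n (⊔ʳ {K} {L} (⊔ʳ {N} {K ⊔ₙ L} (⊔ʳ {M} J≤n))))
          (p′ m n (⊔ˡ {M} J≤m) (⊔ˡ {M} J≤n))
          (q′ m n (⊔ˡ {N} {K ⊔ₙ L} (⊔ʳ {M} J≤m)) (⊔ˡ {N} {K ⊔ₙ L} (⊔ʳ {M} J≤n)))

  const : ℚ → ℝ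
  const q = mkℝ (λ _ → q) λ ε 0<ε → 0 , λ _ _ _ _ →
    subst (λ t → ∣ t ∣ ≤ ε) (sym (+-inverseʳ q)) (<⇒≤ 0<ε)

  infixl 6 _+ᴿ_ _-ᴿ_
  infixl 7 _*ᴿ_
  infix 8 -ᴿ_

  _+ᴿ_ _*ᴿ_ : ℝ → ℝ → ℝ
  mkℝ x p +ᴿ mkℝ y q = mkℝ (λ n → x n + y n) (+-~ {x} {x} {y} {y} p q)
  mkℝ x p *ᴿ mkℝ y q = mkℝ (λ n → x n * y n) (*-~ {x} {x} {y} {y} p q)

  -ᴿ_ : ℝ → ℝ
  -ᴿ mkℝ x p = mkℝ (λ n → - x n) (neg-~ {x} {x} p)

  _-ᴿ_ : ℝ → ℝ → ℝ
  x -ᴿ y = x +ᴿ (-ᴿ y)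

  0ᴿ 1ᴿ : ℝ
  0ᴿ = const 0ℚ
  1ᴿ = const 1ℚ

  pointwise : ∀ {x y} → (∀ n → seq x n ≡ seq y n) → x ≈ y
  pointwise {x} {y} = ~-pointwise {seq x} {seq y} (cauchy x)

  open AlgebraicStructures _≈_ using (IsCommutativeRing)
  open AlgebraicDefinitions _≈_ using (Invertible)

  ≈-isEquivalence : IsEquivalence _≈_
  ≈-isEquivalence = record
    { refl  = λ {x} → cauchy x
    ; sym   = λ {x} {y} → ~-sym {seq x} {seq y}
    ; trans = λ {x} {y} {z} → ~-trans {seq x} {seq y} {seq z}
    }

  isCommutativeRing : IsCommutativeRing _+ᴿ_ _*ᴿ_ -ᴿ_ 0ᴿ 1ᴿ
  isCommutativeRing = record
    { isRing = record
      { +-isAbelianGroup = record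
        { isGroup = record
          { isMonoid = record
            { isSemigroup = record
              { isMagma = record
                { isEquivalence = ≈-isEquivalence
                ; ∙-cong = λ {x} {x′} {y} {y′} → +-~ {seq x} {seq x′} {seq y} {seq y′}
                }
              ; assoc = λ x y z → pointwise {(x +ᴿ y) +ᴿ z} {x +ᴿ (y +ᴿ z)} λ n → +-assoc (seq x n) (seq y n) (seq z n)
              }
            ; identity = (λ x → pointwise {0ᴿ +ᴿ x} {x} λ n → +-identityˡ (seq x n))
                       , (λ x → pointwise {x +ᴿ 0ᴿ} {x} λ n → +-identityʳ (seq x n))
            }
          ; inverse = (λ x → pointwise { -ᴿ x +ᴿ x} {0ᴿ} λ n → +-inverseˡ (seq x n))
                    , (λ x → pointwise {x +ᴿ (-ᴿ x)} {0ᴿ} λ n → +-inverseʳ (seq x n))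
          ; ⁻¹-cong = λ {x} {y} → neg-~ {seq x} {seq y}
          }
        ; comm = λ x y → pointwise {x +ᴿ y} {y +ᴿ x} λ n → +-comm (seq x n) (seq y n)
        }
      ; *-cong = λ {x} {x′} {y} {y′} → *-~ {seq x} {seq x′} {seq y} {seq y′}
      ; *-assoc = λ x y z → pointwise {(x *ᴿ y) *ᴿ z} {x *ᴿ (y *ᴿ z)} λ n → *-assoc (seq x n) (seq y n) (seq z n)
      ; *-identity = (λ x → pointwise {1ᴿ *ᴿ x} {x} λ n → *-identityˡ (seq x n))
                   , (λ x → pointwise {x *ᴿ 1ᴿ} {x} λ n → *-identityʳ (seq x n))
      ; distrib = (λ x y z → pointwise {x *ᴿ (y +ᴿ z)} {x *ᴿ y +ᴿ x *ᴿ z} λ n → *-distribˡ-+ (seq x n) (seq y n) (seq z n))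
                , (λ x y z → pointwise {(y +ᴿ z) *ᴿ x} {y *ᴿ x +ᴿ z *ᴿ x} λ n → *-distribʳ-+ (seq x n) (seq y n) (seq z n))
      }
    ; *-comm = λ x y → pointwise {x *ᴿ y} {y *ᴿ x} λ n → *-comm (seq x n) (seq y n)
    }

  private
    recip : ℚ → ℚ
    recip p with p ≟ 0ℚ
    ... | yes _   = 0ℚ
    ... | no  p≢0 = (1/ p) {{≢-nonZero p≢0}}

    recip-inverse : ∀ p → p ≢ 0ℚ → recip p * p ≡ 1ℚ
    recip-inverse p p≢0 with p ≟ 0ℚ
    ... | yes p≡0 = ⊥-elim (p≢0 p≡0)
    ... | no  p≢0′ = *-inverseˡ p {{≢-nonZero p≢0′}}

    ∣∣-bounded⇒≢0 : ∀ {δ} p → 0ℚ < δ → δ ≤ ∣ p ∣ → p ≢ 0ℚ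
    ∣∣-bounded⇒≢0 p 0<δ δ≤∣p∣ refl = <-irrefl refl (<-≤-trans 0<δ δ≤∣p∣)

    recip-bound : ∀ {δ} p (0<δ : 0ℚ < δ) → δ ≤ ∣ p ∣ → ∣ recip p ∣ ≤ (1/ δ) {{>-nonZero 0<δ}}
    recip-bound {δ} p 0<δ δ≤∣p∣ = *-cancelʳ-≤-pos δ {{positive 0<δ}} (begin
      ∣ recip p ∣ * δ      ≤⟨ *-monoˡ (0≤∣p∣ (recip p)) δ≤∣p∣ ⟩
      ∣ recip p ∣ * ∣ p ∣  ≡⟨ sym (∣p*q∣≡∣p∣*∣q∣ (recip p) p) ⟩
      ∣ recip p * p ∣      ≡⟨ cong ∣_∣ (recip-inverse p (∣∣-bounded⇒≢0 p 0<δ δ≤∣p∣)) ⟩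
      1ℚ                   ≡⟨ sym (*-inverseˡ δ) ⟩
      1/ δ * δ             ∎)
      where
      open ≤-Reasoning
      instance _ = >-nonZero 0<δ

    recip-~ : ∀ {x} → x ~ x → ∀ δ → 0ℚ < δ → ∃[ N ] (∀ n → N ℕ.≤ n → δ ≤ ∣ x n ∣) →
      (λ n → recip (x n)) ~ (λ n → recip (x n))
    recip-~ {x} p δ 0<δ (N , b) =
      ~-scale {λ n → recip (x n)} {λ n → recip (x n)} (r * r) (*-pos 0<r 0<r) λ ε 0<ε →
      let M , q = p ε 0<ε in M ⊔ₙ N , λ m n K≤m K≤n →
        bound (x m) (x n) (b m (⊔ʳ {M} K≤m)) (b n (⊔ʳ {M} K≤n)) 0<ε (q n m (⊔ˡ K≤n) (⊔ˡ K≤m))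
      where
      open ≤-Reasoning
      instance _ = >-nonZero 0<δ
      r = 1/ δ
      0<r : 0ℚ < r
      0<r = 1/-pos 0<δ
      diff : ∀ a b → a ≢ 0ℚ → b ≢ 0ℚ → recip a - recip b ≡ recip a * recip b * (b - a)
      diff a b a≢0 b≢0 = sym (trans (recip-diff (recip a) (recip b) a b)
        (cong₂ _-_ (trans (cong (recip a *_) (recip-inverse b b≢0)) (*-identityʳ (recip a)))
                   (trans (cong (recip b *_) (recip-inverse a a≢0)) (*-identityʳ (recip b)))))
      bound : ∀ a b {ε} → δ ≤ ∣ a ∣ → δ ≤ ∣ b ∣ → 0ℚ < ε → ∣ b - a ∣ ≤ ε → ∣ recip a - recip b ∣ ≤ r * r * ε
      bound a b {ε} δ≤a δ≤b 0<ε h = begin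
        ∣ recip a - recip b ∣
          ≡⟨ cong ∣_∣ (diff a b (∣∣-bounded⇒≢0 a 0<δ δ≤a) (∣∣-bounded⇒≢0 b 0<δ δ≤b)) ⟩
        ∣ recip a * recip b * (b - a) ∣
          ≡⟨ ∣p*q∣≡∣p∣*∣q∣ (recip a * recip b) (b - a) ⟩
        ∣ recip a * recip b ∣ * ∣ b - a ∣
          ≤⟨ *-mono (0≤∣p∣ (recip a * recip b)) (<⇒≤ 0<ε) ab h ⟩
        r * r * ε ∎
        where
        ab : ∣ recip a * recip b ∣ ≤ r * r
        ab = begin
          ∣ recip a * recip b ∣     ≡⟨ ∣p*q∣≡∣p∣*∣q∣ (recip a) (recip b) ⟩
          ∣ recip a ∣ * ∣ recip b ∣ ≤⟨ *-mono (0≤∣p∣ (recip a)) (<⇒≤ 0<r) (recip-bound a 0<δ δ≤a) (recip-bound b 0<δ δ≤b) ⟩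
          r * r                     ∎

    separated : ∀ x y {δ} N →
      (∀ n → N ℕ.≤ n → ∣ seq x N - seq x n ∣ ≤ δ) → (∀ n → N ℕ.≤ n → ∣ seq y n - seq y N ∣ ≤ δ) →
      δ + δ + δ ≤ ∣ seq x N - seq y N ∣ →
      ∀ n → N ℕ.≤ n → δ ≤ ∣ seq x n - seq y n ∣
    separated (mkℝ x _) (mkℝ y _) {δ} N hx hy far n N≤n =
      subst₂≤ (cancel-eqˡ δ) (cancel-eqʳ δ ∣ x n - y n ∣)
        (+-monoˡ-≤ (- δ - δ) (≤-trans far
          (≤-trans (triangle (x N) (x n) (y N))
            (+-mono-≤ (hx n N≤n) (≤-trans (triangle (x n) (y n) (y N))
              (+-monoʳ-≤ ∣ x n - y n ∣ (hy n N≤n)))))))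
      where
      subst₂≤ : ∀ {a b c d} → a ≡ b → c ≡ d → a ≤ c → b ≤ d
      subst₂≤ refl refl h = h

  #-irrefl : ∀ {x y} → x ≈ y → ¬ x # y
  #-irrefl x≈y (ε , 0<ε , N , far) with x≈y (½ * ε) (*-pos 0<½ 0<ε)
  ... | M , near = <-irrefl refl (≤-<-trans (≤-trans (far K (ℕ.m≤n⊔m M N))
        (near K K (ℕ.m≤m⊔n M N) (ℕ.m≤m⊔n M N))) (half< 0<ε))
    where K = M ⊔ₙ N

  #-sym : ∀ {x y} → x # y → y # x
  #-sym {x} {y} (ε , 0<ε , N , far) =
    ε , 0<ε , N , λ n N≤n → subst (ε ≤_) (flip-∣∣ (seq x n) (seq y n)) (far n N≤n)

  #-cotrans : ∀ {x y} → x # y → ∀ z → x # z ⊎ z # y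
  #-cotrans {x} {y} (ε , 0<ε , N , far) z
    with cauchy x (sixth * ε) 0<δ | cauchy y (sixth * ε) 0<δ | cauchy z (sixth * ε) 0<δ
    where
    0<δ : 0ℚ < sixth * ε
    0<δ = *-pos (positive⁻¹ sixth) 0<ε
  ... | Nx , hx | Ny , hy | Nz , hz = split (t ≤? ∣ seq x K - seq z K ∣) (t ≤? ∣ seq z K - seq y K ∣)
    where
    δ = sixth * ε
    t = δ + δ + δ
    0<δ : 0ℚ < δ
    0<δ = *-pos (positive⁻¹ sixth) 0<ε
    K = N ⊔ₙ (Nx ⊔ₙ (Ny ⊔ₙ Nz))
    N≤ : ∀ {n} → K ℕ.≤ n → N ℕ.≤ n
    N≤ = ⊔ˡ {N}
    x≤ : ∀ {n} → K ℕ.≤ n → Nx ℕ.≤ n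
    x≤ h = ⊔ˡ {Nx} (⊔ʳ {N} h)
    y≤ : ∀ {n} → K ℕ.≤ n → Ny ℕ.≤ n
    y≤ h = ⊔ˡ {Ny} (⊔ʳ {Nx} (⊔ʳ {N} h))
    z≤ : ∀ {n} → K ℕ.≤ n → Nz ℕ.≤ n
    z≤ h = ⊔ʳ {Ny} (⊔ʳ {Nx} (⊔ʳ {N} h))
    K≤K : K ℕ.≤ K
    K≤K = ℕ.≤-refl
    split : Dec (t ≤ ∣ seq x K - seq z K ∣) → Dec (t ≤ ∣ seq z K - seq y K ∣) → x # z ⊎ z # y
    split (yes p) _ = inj₁ (δ , 0<δ , K , separated x z K
      (λ n h → hx K n (x≤ K≤K) (x≤ h)) (λ n h → hz n K (z≤ h) (z≤ K≤K)) p)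
    split (no _) (yes q) = inj₂ (δ , 0<δ , K , separated z y K
      (λ n h → hz K n (z≤ K≤K) (z≤ h)) (λ n h → hy n K (y≤ h) (y≤ K≤K)) q)
    split (no ¬p) (no ¬q) = ⊥-elim (<-irrefl refl (≤-<-trans (far K (N≤ K≤K))
      (≤-<-trans (triangle (seq x K) (seq z K) (seq y K))
        (subst (∣ seq x K - seq z K ∣ + ∣ seq z K - seq y K ∣ <_) (six-eq ε)
          (+-mono-< (≰⇒> ¬p) (≰⇒> ¬q))))))

  ¬#⇒≈ : ∀ x y → ¬ x # y → x ≈ y
  ¬#⇒≈ x y ¬x#y = ~-scale {seq x} {seq y} five (positive⁻¹ five) near
    where
    near : ∀ δ → 0ℚ < δ →
      ∃[ N ] (∀ m n → N ℕ.≤ m → N ℕ.≤ n → ∣ seq x m - seq y n ∣ ≤ five * δ)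
    near δ 0<δ with cauchy x δ 0<δ | cauchy y δ 0<δ
    ... | Nx , hx | Ny , hy = K , λ m n K≤m K≤n →
      subst (∣ seq x m - seq y n ∣ ≤_) (five-eq δ)
        (≤-trans (triangle (seq x m) (seq x K) (seq y n))
          (+-mono-≤ (hx m K (x≤ K≤m) (x≤ K≤K))
            (≤-trans (triangle (seq x K) (seq y K) (seq y n))
              (+-mono-≤ (<⇒≤ close) (hy K n (y≤ K≤K) (y≤ K≤n))))))
      where
      K = Nx ⊔ₙ Ny
      K≤K : K ℕ.≤ K
      K≤K = ℕ.≤-refl
      x≤ : ∀ {n} → K ℕ.≤ n → Nx ℕ.≤ n
      x≤ = ⊔ˡ {Nx}
      y≤ : ∀ {n} → K ℕ.≤ n → Ny ℕ.≤ n
      y≤ = ⊔ʳ {Nx}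
      close : ∣ seq x K - seq y K ∣ < δ + δ + δ
      close = ≰⇒> λ far → ¬x#y (δ , 0<δ , K , separated x y K
        (λ n h → hx K n (x≤ K≤K) (x≤ h)) (λ n h → hy n K (y≤ h) (y≤ K≤K)) far)

  #⇒invertible : ∀ {x y} → x # y → Invertible 1ᴿ _*ᴿ_ (x -ᴿ y)
  #⇒invertible {x} {y} (δ , 0<δ , N , far) = w⁻¹ , eqˡ , ~-trans {seq (w *ᴿ w⁻¹)} {seq (w⁻¹ *ᴿ w)} {seq 1ᴿ}
      (pointwise {w *ᴿ w⁻¹} {w⁻¹ *ᴿ w} λ n → *-comm (seq w n) (seq w⁻¹ n)) eqˡ
    where
    w = x -ᴿ y
    w⁻¹ : ℝ
    w⁻¹ = mkℝ (λ n → recip (seq w n)) (recip-~ {seq w} (cauchy w) δ 0<δ (N , far))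
    eqˡ : w⁻¹ *ᴿ w ≈ 1ᴿ
    eqˡ = ~-eventually {seq (w⁻¹ *ᴿ w)} {seq 1ᴿ} (cauchy (w⁻¹ *ᴿ w))
      (N , λ n N≤n → recip-inverse (seq w n) (∣∣-bounded⇒≢0 (seq w n) 0<δ (far n N≤n)))

  invertible⇒# : ∀ {x y} → Invertible 1ᴿ _*ᴿ_ (x -ᴿ y) → x # y
  invertible⇒# {x} {y} (z , _ , wz≈1) = go (bounded {seq z} (cauchy z)) (wz≈1 ½ 0<½)
    where
    open ≤-Reasoning
    w = x -ᴿ y
    go : Bounded (seq z) →
      ∃[ N ] (∀ m n → N ℕ.≤ m → N ℕ.≤ n → ∣ seq w m * seq z m - 1ℚ ∣ ≤ ½) → x # y
    go (B , 0<B , M , zB) (N , near) = ½ * 1/ B , *-pos 0<½ (1/-pos 0<B) , M ⊔ₙ N , far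
      where
      instance _ = >-nonZero 0<B
      far : ∀ n → M ⊔ₙ N ℕ.≤ n → ½ * 1/ B ≤ ∣ seq x n - seq y n ∣
      far n K≤n = *-cancelʳ-≤-pos B {{positive 0<B}} (begin
        ½ * 1/ B * B       ≡⟨ trans (*-assoc ½ (1/ B) B) (trans (cong (½ *_) (*-inverseˡ B)) (*-identityʳ ½)) ⟩
        ½                  ≤⟨ +-monoʳ-≤ (- ½) one ⟩
        - ½ + (½ + ∣ a ∣)  ≡⟨ trans (sym (+-assoc (- ½) ½ ∣ a ∣)) (+-identityˡ ∣ a ∣) ⟩
        ∣ a ∣              ≡⟨ ∣p*q∣≡∣p∣*∣q∣ (seq w n) (seq z n) ⟩
        ∣ seq w n ∣ * ∣ seq z n ∣ ≤⟨ *-monoˡ {∣ seq w n ∣} (0≤∣p∣ (seq w n)) (zB n (⊔ˡ {M} K≤n)) ⟩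
        ∣ seq w n ∣ * B    ∎)
        where
        a = seq w n * seq z n
        one : 1ℚ ≤ ½ + ∣ a ∣
        one = begin
          1ℚ                   ≡⟨ cong ∣_∣ (sym (diff-add 1ℚ a)) ⟩
          ∣ (1ℚ - a) + a ∣     ≤⟨ ∣p+q∣≤∣p∣+∣q∣ (1ℚ - a) a ⟩
          ∣ 1ℚ - a ∣ + ∣ a ∣   ≡⟨ cong (_+ ∣ a ∣) (flip-∣∣ 1ℚ a) ⟩
          ∣ a - 1ℚ ∣ + ∣ a ∣   ≤⟨ +-monoˡ-≤ ∣ a ∣ (near n n (⊔ʳ {M} K≤n) (⊔ʳ {M} K≤n)) ⟩
          ½ + ∣ a ∣            ∎

  heytingField : HeytingField 0ℓ 0ℓ 0ℓ
  heytingField = record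
    { Carrier = ℝ ; _≈_ = _≈_ ; _#_ = _#_ ; _+_ = _+ᴿ_ ; _*_ = _*ᴿ_ ; -_ = -ᴿ_ ; 0# = 0ᴿ ; 1# = 1ᴿ
    ; isHeytingField = record
      { isHeytingCommutativeRing = record
        { isCommutativeRing   = isCommutativeRing
        ; isApartnessRelation = record
          { irrefl  = λ {x} {y} → #-irrefl {x} {y}
          ; sym     = λ {x} {y} → #-sym {x} {y}
          ; cotrans = λ {x} {y} → #-cotrans {x} {y}
          }
        ; #⇒invertible = λ {x} {y} → #⇒invertible {x} {y}
        ; invertible⇒# = λ {x} {y} → invertible⇒# {x} {y}
        }
      ; tight = λ x y → ¬#⇒≈ x y , #-irrefl {x} {y}
      }
    }

  private
    square-∣∣ : ∀ p → p * p ≡ ∣ p ∣ * ∣ p ∣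
    square-∣∣ p with ∣p∣≡p∨∣p∣≡-p p
    ... | inj₁ e rewrite e = refl
    ... | inj₂ e rewrite e = neg-square p
      where
      neg-square : ∀ q → q * q ≡ - q * - q
      neg-square = solve 1 (λ q → q :* q := (:- q) :* (:- q)) refl

    0≤square : ∀ p → 0ℚ ≤ p * p
    0≤square p = subst (0ℚ ≤_) (sym (square-∣∣ p))
      (subst (_≤ ∣ p ∣ * ∣ p ∣) (*-zeroʳ ∣ p ∣) (*-monoˡ (0≤∣p∣ p) (0≤∣p∣ p)))

    ≤∣∣ : ∀ {δ p} → 0ℚ ≤ δ → δ ≤ p → δ ≤ ∣ p - 0ℚ ∣
    ≤∣∣ {δ} {p} 0≤δ δ≤p = subst (δ ≤_)
      (trans (sym (0≤p⇒∣p∣≡p (≤-trans 0≤δ δ≤p))) (cong ∣_∣ (sym (+-identityʳ p)))) δ≤p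

  sum-of-squares#0 : SumOfSquares#0 heytingField
  sum-of-squares#0 (mkℝ x _) (mkℝ y _) (δ , 0<δ , N , far) = δ * δ , *-pos 0<δ 0<δ , N , λ n N≤n →
    ≤∣∣ (<⇒≤ (*-pos 0<δ 0<δ)) (begin
      δ * δ                   ≤⟨ *-mono 0≤δ (0≤∣p∣ (x n)) (δ≤ n N≤n) (δ≤ n N≤n) ⟩
      ∣ x n ∣ * ∣ x n ∣       ≡⟨ sym (square-∣∣ (x n)) ⟩
      x n * x n               ≡⟨ sym (+-identityʳ (x n * x n)) ⟩
      x n * x n + 0ℚ          ≤⟨ +-monoʳ-≤ (x n * x n) (0≤square (y n)) ⟩
      x n * x n + y n * y n   ∎)
    where
    open ≤-Reasoning
    0≤δ = <⇒≤ 0<δ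
    δ≤ : ∀ n → N ℕ.≤ n → δ ≤ ∣ x n ∣
    δ≤ n N≤n = subst (λ t → δ ≤ ∣ t ∣) (+-identityʳ (x n)) (far n N≤n)

  characteristicZero : CharacteristicZero heytingField
  characteristicZero n = 1ℚ , 0<1 , 0 , λ k _ → ≤∣∣ 0≤1
    (subst (_≤ 1ℚ + seq (natural heytingField n) k) (+-identityʳ 1ℚ) (+-monoʳ-≤ 1ℚ (nonneg n k)))
    where
    nonneg : ∀ n k → 0ℚ ≤ seq (natural heytingField n) k
    nonneg zero    k = ≤-refl
    nonneg (suc n) k =
      subst (_≤ 1ℚ + seq (natural heytingField n) k) (+-identityʳ 0ℚ) (+-mono-≤ 0≤1 (nonneg n k))

module AdjoinI {c ℓ₁ ℓ₂} (F : HeytingField c ℓ₁ ℓ₂) (sum-of-squares#0 : SumOfSquares#0 F) where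

  open HeytingField F
  open import Algebra.Apartness.Properties.HeytingCommutativeRing heytingCommutativeRing
  open CommutativeRing (fieldRing F) using (ring; commutativeSemiring)
  open import Algebra.Properties.Ring ring using (-1*x≈-x; -‿distribˡ-*; -‿distribʳ-*; -0#≈0#; -‿involutive)
  open import Algebra.Solver.Ring.NaturalCoefficients.Default commutativeSemiring
    using (solve; _:=_; _:+_; _:*_)
  open import Relation.Binary.Reasoning.Setoid setoid

  infix 5 _+i_

  record Complex : Set c where
    constructor _+i_
    field
      re im : Carrier
  open Complex public

  infix 4 _≈ᶜ_ _#ᶜ_
  infixl 6 _+ᶜ_
  infixl 7 _*ᶜ_
  infix 8 -ᶜ_

  _≈ᶜ_ : Complex → Complex → Set ℓ₁
  z ≈ᶜ w = re z ≈ re w × im z ≈ im w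

  _#ᶜ_ : Complex → Complex → Set ℓ₂
  z #ᶜ w = re z # re w ⊎ im z # im w

  _+ᶜ_ _*ᶜ_ : Complex → Complex → Complex
  (a +i b) +ᶜ (c +i d) = (a + c) +i (b + d)
  (a +i b) *ᶜ (c +i d) = (a * c - b * d) +i (a * d + b * c)

  -ᶜ_ : Complex → Complex
  -ᶜ (a +i b) = (- a) +i (- b)

  ofReal : Carrier → Complex
  ofReal a = a +i 0#

  0ᶜ 1ᶜ : Complex
  0ᶜ = ofReal 0#
  1ᶜ = ofReal 1#

  private
    -- Writing − x as j x turns the ring laws below into commutative semiring identities.
    j : Carrier
    j = - 1#

    minus : ∀ x y → x - y ≈ x + j * y
    minus x y = +-congˡ (sym (-1*x≈-x y))

    assoc-re : ∀ a b c d e f →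
      (a * c - b * d) * e - (a * d + b * c) * f ≈ a * (c * e - d * f) - b * (c * f + d * e)
    assoc-re a b c d e f = begin
      (a * c - b * d) * e - (a * d + b * c) * f
        ≈⟨ trans (minus _ _) (+-congʳ (*-congʳ (minus (a * c) (b * d)))) ⟩
      (a * c + j * (b * d)) * e + j * ((a * d + b * c) * f)
        ≈⟨ solve 7 (λ j a b c d e f → (a :* c :+ j :* (b :* d)) :* e :+ j :* ((a :* d :+ b :* c) :* f)
             := a :* (c :* e :+ j :* (d :* f)) :+ j :* (b :* (c :* f :+ d :* e))) refl j a b c d e f ⟩
      a * (c * e + j * (d * f)) + j * (b * (c * f + d * e))
        ≈⟨ trans (minus _ _) (+-congʳ (*-congˡ (minus (c * e) (d * f)))) ⟨
      a * (c * e - d * f) - b * (c * f + d * e) ∎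

    assoc-im : ∀ a b c d e f →
      (a * c - b * d) * f + (a * d + b * c) * e ≈ a * (c * f + d * e) + b * (c * e - d * f)
    assoc-im a b c d e f = begin
      (a * c - b * d) * f + (a * d + b * c) * e
        ≈⟨ +-congʳ (*-congʳ (minus (a * c) (b * d))) ⟩
      (a * c + j * (b * d)) * f + (a * d + b * c) * e
        ≈⟨ solve 7 (λ j a b c d e f → (a :* c :+ j :* (b :* d)) :* f :+ (a :* d :+ b :* c) :* e
             := a :* (c :* f :+ d :* e) :+ b :* (c :* e :+ j :* (d :* f))) refl j a b c d e f ⟩
      a * (c * f + d * e) + b * (c * e + j * (d * f))
        ≈⟨ +-congˡ (*-congˡ (minus (c * e) (d * f))) ⟨
      a * (c * f + d * e) + b * (c * e - d * f) ∎

    distrib-re : ∀ a b c d e f →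
      a * (c + e) - b * (d + f) ≈ (a * c - b * d) + (a * e - b * f)
    distrib-re a b c d e f = begin
      a * (c + e) - b * (d + f)
        ≈⟨ minus _ _ ⟩
      a * (c + e) + j * (b * (d + f))
        ≈⟨ solve 7 (λ j a b c d e f → a :* (c :+ e) :+ j :* (b :* (d :+ f))
             := (a :* c :+ j :* (b :* d)) :+ (a :* e :+ j :* (b :* f))) refl j a b c d e f ⟩
      (a * c + j * (b * d)) + (a * e + j * (b * f))
        ≈⟨ +-cong (minus (a * c) (b * d)) (minus (a * e) (b * f)) ⟨
      (a * c - b * d) + (a * e - b * f) ∎

    distrib-im : ∀ a b c d e f →
      a * (d + f) + b * (c + e) ≈ (a * d + b * c) + (a * f + b * e)
    distrib-im = solve 6 (λ a b c d e f → a :* (d :+ f) :+ b :* (c :+ e)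
      := (a :* d :+ b :* c) :+ (a :* f :+ b :* e)) refl

    norm-re : ∀ a b v → a * (a * v) - b * (- b * v) ≈ (a * a + b * b) * v
    norm-re a b v = begin
      a * (a * v) - b * (- b * v)
        ≈⟨ +-congˡ (-‿cong (trans (*-congˡ (sym (-‿distribˡ-* b v))) (sym (-‿distribʳ-* b (b * v))))) ⟩
      a * (a * v) + - (- (b * (b * v)))
        ≈⟨ +-congˡ (-‿involutive _) ⟩
      a * (a * v) + b * (b * v)
        ≈⟨ solve 3 (λ a b v → a :* (a :* v) :+ b :* (b :* v) := (a :* a :+ b :* b) :* v) refl a b v ⟩
      (a * a + b * b) * v ∎

    norm-im : ∀ a b v → a * (- b * v) + b * (a * v) ≈ 0#
    norm-im a b v = begin
      a * (- b * v) + b * (a * v)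
        ≈⟨ +-congʳ (trans (*-congˡ (sym (-‿distribˡ-* b v))) (sym (-‿distribʳ-* a (b * v)))) ⟩
      - (a * (b * v)) + b * (a * v)
        ≈⟨ +-congˡ (solve 3 (λ a b v → b :* (a :* v) := a :* (b :* v)) refl a b v) ⟩
      - (a * (b * v)) + a * (b * v)
        ≈⟨ -‿inverseˡ _ ⟩
      0# ∎

  open AlgebraicStructures _≈ᶜ_ using (IsCommutativeRing)
  open AlgebraicDefinitions _≈ᶜ_ using (Invertible)

  *ᶜ-comm : ∀ z w → z *ᶜ w ≈ᶜ w *ᶜ z
  *ᶜ-comm (a +i b) (c +i d) =
    +-cong (*-comm a c) (-‿cong (*-comm b d)) ,
    trans (+-cong (*-comm a d) (*-comm b c)) (+-comm (d * a) (c * b))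

  *ᶜ-identityˡ : ∀ z → 1ᶜ *ᶜ z ≈ᶜ z
  *ᶜ-identityˡ (a +i b) =
    trans (+-cong (*-identityˡ a) (trans (-‿cong (zeroˡ b)) -0#≈0#)) (+-identityʳ a) ,
    trans (+-cong (*-identityˡ b) (zeroˡ a)) (+-identityʳ b)

  ≈ᶜ-trans : ∀ {x y z} → x ≈ᶜ y → y ≈ᶜ z → x ≈ᶜ z
  ≈ᶜ-trans (p , q) (p′ , q′) = trans p p′ , trans q q′

  *ᶜ-distribˡ : ∀ x y z → x *ᶜ (y +ᶜ z) ≈ᶜ x *ᶜ y +ᶜ x *ᶜ z
  *ᶜ-distribˡ (a +i b) (c +i d) (e +i f) = distrib-re a b c d e f , distrib-im a b c d e f

  +ᶜ-cong : ∀ {x y z w} → x ≈ᶜ y → z ≈ᶜ w → x +ᶜ z ≈ᶜ y +ᶜ w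
  +ᶜ-cong (p , q) (p′ , q′) = +-cong p p′ , +-cong q q′

  isCommutativeRingᶜ : IsCommutativeRing _+ᶜ_ _*ᶜ_ -ᶜ_ 0ᶜ 1ᶜ
  isCommutativeRingᶜ = record
    { isRing = record
      { +-isAbelianGroup = record
        { isGroup = record
          { isMonoid = record
            { isSemigroup = record
              { isMagma = record
                { isEquivalence = record
                  { refl  = refl , refl
                  ; sym   = λ (p , q) → sym p , sym q
                  ; trans = ≈ᶜ-trans
                  }
                ; ∙-cong = +ᶜ-cong
                }
              ; assoc = λ x y z → +-assoc (re x) (re y) (re z) , +-assoc (im x) (im y) (im z)
              }
            ; identity = (λ x → +-identityˡ (re x) , +-identityˡ (im x))
                       , (λ x → +-identityʳ (re x) , +-identityʳ (im x))
            }
          ; inverse = (λ x → -‿inverseˡ (re x) , -‿inverseˡ (im x))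
                    , (λ x → -‿inverseʳ (re x) , -‿inverseʳ (im x))
          ; ⁻¹-cong = λ (p , q) → -‿cong p , -‿cong q
          }
        ; comm = λ x y → +-comm (re x) (re y) , +-comm (im x) (im y)
        }
      ; *-cong = λ (p , q) (p′ , q′) →
          +-cong (*-cong p p′) (-‿cong (*-cong q q′)) , +-cong (*-cong p q′) (*-cong q p′)
      ; *-assoc = λ (a +i b) (c +i d) (e +i f) → assoc-re a b c d e f , assoc-im a b c d e f
      ; *-identity = *ᶜ-identityˡ , λ z → ≈ᶜ-trans (*ᶜ-comm z 1ᶜ) (*ᶜ-identityˡ z)
      ; distrib = *ᶜ-distribˡ , λ x y z → ≈ᶜ-trans (*ᶜ-comm (y +ᶜ z) x)
          (≈ᶜ-trans (*ᶜ-distribˡ x y z) (+ᶜ-cong (*ᶜ-comm x y) (*ᶜ-comm x z)))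
      }
    ; *-comm = *ᶜ-comm
    }

  private
    -#0 : ∀ {x y} → x # y → x - y # 0#
    -#0 {x} {y} x#y with #⇒invertible x#y
    ... | v , vl , _ = invertibleˡ⇒# (v , trans (*-congˡ (x-0≈x (x - y))) vl)

    -#0⁻¹ : ∀ {x y} → x - y # 0# → x # y
    -#0⁻¹ {x} {y} p with #⇒invertible p
    ... | v , vl , _ = invertibleˡ⇒# (v , trans (*-congˡ (sym (x-0≈x (x - y)))) vl)

    factor#0 : ∀ {x y} → x * y # 0# → x # 0#
    factor#0 {x} {y} p with #⇒invertible p
    ... | v , vl , _ = invertibleˡ⇒# (v * y , (begin
      v * y * (x - 0#)   ≈⟨ *-congˡ (x-0≈x x) ⟩
      v * y * x          ≈⟨ solve 3 (λ v x y → v :* y :* x := v :* (x :* y)) refl v x y ⟩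
      v * (x * y)        ≈⟨ *-congˡ (x-0≈x (x * y)) ⟨
      v * (x * y - 0#)   ≈⟨ vl ⟩
      1#                 ∎))

    norm#0 : ∀ {a b} → a # 0# ⊎ b # 0# → a * a + b * b # 0#
    norm#0 {a} {b} (inj₁ p) = sum-of-squares#0 a b p
    norm#0 {a} {b} (inj₂ p) = #-congʳ (+-comm (b * b) (a * a)) (sum-of-squares#0 b a p)

    -#0-split : ∀ {x y} → x - y # 0# → x # 0# ⊎ y # 0#
    -#0-split {x} {y} p = Sum.map₂ #-sym (#-cotrans (-#0⁻¹ p) 0#)

  #ᶜ⇒invertible : ∀ {x y} → x #ᶜ y → Invertible 1ᶜ _*ᶜ_ (x +ᶜ -ᶜ y)
  #ᶜ⇒invertible {x} {y} p with #⇒invertible (norm#0 {re x - re y} {im x - im y} (Sum.map -#0 -#0 p))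
  ... | v , _ , vr = d⁻¹ , ≈ᶜ-trans (*ᶜ-comm d⁻¹ (a +i b)) eq , eq
    where
    a = re x - re y
    b = im x - im y
    d⁻¹ : Complex
    d⁻¹ = (a * v) +i (- b * v)
    eq : (a +i b) *ᶜ d⁻¹ ≈ᶜ 1ᶜ
    eq = trans (norm-re a b v) (trans (*-congʳ (sym (x-0≈x (a * a + b * b)))) vr) , norm-im a b v

  invertible⇒#ᶜ : ∀ {x y} → Invertible 1ᶜ _*ᶜ_ (x +ᶜ -ᶜ y) → x #ᶜ y
  invertible⇒#ᶜ (_ , _ , (re≈1 , _)) =
    Sum.map (-#0⁻¹ ∘′ factor#0) (-#0⁻¹ ∘′ factor#0) (-#0-split (#-congʳ (sym re≈1) 1#0))

  heytingFieldᶜ : HeytingField c ℓ₁ ℓ₂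
  heytingFieldᶜ = record
    { Carrier = Complex ; _≈_ = _≈ᶜ_ ; _#_ = _#ᶜ_ ; _+_ = _+ᶜ_ ; _*_ = _*ᶜ_ ; -_ = -ᶜ_ ; 0# = 0ᶜ ; 1# = 1ᶜ
    ; isHeytingField = record
      { isHeytingCommutativeRing = record
        { isCommutativeRing   = isCommutativeRingᶜ
        ; isApartnessRelation = record
          { irrefl  = irreflᶜ
          ; sym     = Sum.map #-sym #-sym
          ; cotrans = λ { (inj₁ p) z → Sum.map inj₁ inj₁ (#-cotrans p (re z))
                        ; (inj₂ p) z → Sum.map inj₂ inj₂ (#-cotrans p (im z)) }
          }
        ; #⇒invertible = #ᶜ⇒invertible
        ; invertible⇒# = invertible⇒#ᶜ
        }
      ; tight = λ x y →
          (λ ¬p → proj₁ (tight (re x) (re y)) (λ p → ¬p (inj₁ p))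
                , proj₁ (tight (im x) (im y)) (λ p → ¬p (inj₂ p)))
          , irreflᶜ
      }
    }
    where
    irreflᶜ : ∀ {x y} → x ≈ᶜ y → ¬ x #ᶜ y
    irreflᶜ (p , _) (inj₁ x#y) = #-irrefl p x#y
    irreflᶜ (_ , q) (inj₂ x#y) = #-irrefl q x#y

  characteristicZeroᶜ : CharacteristicZero F → CharacteristicZero heytingFieldᶜ
  characteristicZeroᶜ charZero n = inj₁ (≡.subst (_# 0#) (≡.sym (re-natural (suc n))) (charZero n))
    where
    re-natural : ∀ m → re (natural heytingFieldᶜ m) ≡.≡ natural F m
    re-natural zero    = ≡.refl
    re-natural (suc m) = ≡.cong (_+_ 1#) (re-natural m)

module Degenerate {c ℓ₁ ℓ₂} (K : HeytingField c ℓ₁ ℓ₂) (charZero : CharacteristicZero K) where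

  open HeytingField K
  open HeytingProperties heytingCommutativeRing using (x-0≈x; 1#0; x#0y#0→xy#0; #-congʳ; invertibleˡ⇒#)

  open CommutativeRing (fieldRing K) using (ring; semiring)
  open RingProperties ring using (-‿distribʳ-*)
  open SemiringSum semiring public using (sum-syntax; sum⁺-syntax; sum-cong-≗)

  fromℕ : ℕ → Carrier
  fromℕ = natural K

  infix  8 _⁻¹
  infixr 8 _^ℤ_
  infixl 7 _/_ _*ˣ_

  record Kˣ : Set (c ⊔ ℓ₂) where
    constructor nonZero
    field
      value   : Carrier
      value#0 : value # 0#
  open Kˣ public

  _⁻¹ : Kˣ → Carrier
  nonZero x x#0 ⁻¹ = proj₁ (#⇒invertible x#0)

  ⁻¹-inverseˡ : ∀ x → x ⁻¹ * value x ≈ 1#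
  ⁻¹-inverseˡ (nonZero x x#0) =
    trans (*-congˡ (sym (x-0≈x x))) (proj₁ (proj₂ (#⇒invertible x#0)))

  ⁻¹-inverseʳ : ∀ x → value x * x ⁻¹ ≈ 1#
  ⁻¹-inverseʳ x = trans (*-comm (value x) (x ⁻¹)) (⁻¹-inverseˡ x)

  _/_ : Carrier → Kˣ → Carrier
  a / x = a * x ⁻¹

  1ˣ : Kˣ
  1ˣ = nonZero 1# 1#0

  _*ˣ_ : Kˣ → Kˣ → Kˣ
  nonZero x x#0 *ˣ nonZero y y#0 = nonZero (x * y) (x#0y#0→xy#0 x#0 y#0)

  invˣ : Kˣ → Kˣ
  invˣ x = nonZero (x ⁻¹)
    (invertibleˡ⇒# (value x , trans (*-congˡ (x-0≈x (x ⁻¹))) (⁻¹-inverseʳ x)))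

  _^ˣ_ : Kˣ → ℕ → Kˣ
  x ^ˣ zero  = 1ˣ
  x ^ˣ suc n = x *ˣ (x ^ˣ n)

  _^ℤ_ : Kˣ → ℤ → Kˣ
  x ^ℤ (+ n)    = x ^ˣ n
  x ^ℤ -[1+ n ] = invˣ x ^ˣ suc n

  fromℕˣ : (n : ℕ) → .{{ℕ.NonZero n}} → Kˣ
  fromℕˣ (suc n) = nonZero (fromℕ (suc n)) (charZero n)

  factorial : ℕ → Kˣ
  factorial n = fromℕˣ (n !) {{n ℕ.!≢0}}

  PowerSeries : Set c
  PowerSeries = ℕ → Carrier

  infixl 6 _⊖_
  infixl 7 _⊛_ _•_

  constant : Carrier → PowerSeries
  constant a zero    = a
  constant a (suc n) = 0#

  _⊖_ _⊛_ : PowerSeries → PowerSeries → PowerSeries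
  (f ⊖ g) n = f n - g n
  (f ⊛ g) n = ∑[ i ≤ n ] (f (toℕ i) * g (n ∸ toℕ i))

  _•_ : Carrier → PowerSeries → PowerSeries
  (a • f) n = a * f n

  _^ᴾ_ : PowerSeries → ℕ → PowerSeries
  f ^ᴾ zero  = constant 1#
  f ^ᴾ suc j = f ⊛ (f ^ᴾ j)

  -- f(g(t)).  Since g has no constant term, gʲ contributes to tⁿ only for j ≤ n.
  substitute : PowerSeries → (g : PowerSeries) → g 0 ≈ 0# → PowerSeries
  substitute f g _ n = ∑[ j ≤ n ] (f (toℕ j) * (g ^ᴾ toℕ j) n)

  -- Coefficients 0, …, n of 1/f, highest first: bₙ₊₁ = − f₀⁻¹ (f₁ bₙ + ⋯ + fₙ₊₁ b₀).
  reciprocals : (f : PowerSeries) → f 0 # 0# → (n : ℕ) → Vector Carrier (suc n)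
  reciprocals f f₀#0 zero    = nonZero (f 0) f₀#0 ⁻¹ ∷ Vector.[]
  reciprocals f f₀#0 (suc n) =
    - (nonZero (f 0) f₀#0 ⁻¹ * ∑[ i ≤ n ] (f (suc (toℕ i)) * reciprocals f f₀#0 n i))
    ∷ reciprocals f f₀#0 n

  reciprocal : (f : PowerSeries) → f 0 # 0# → PowerSeries
  reciprocal f f₀#0 n = Vector.head (reciprocals f f₀#0 n)

  private
    reciprocals-lookup : ∀ f f₀#0 n i → reciprocals f f₀#0 n i ≡.≡ reciprocal f f₀#0 (n ∸ toℕ i)
    reciprocals-lookup f f₀#0 zero    zero    = ≡.refl
    reciprocals-lookup f f₀#0 (suc n) zero    = ≡.refl
    reciprocals-lookup f f₀#0 (suc n) (suc i) = reciprocals-lookup f f₀#0 n i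

  reciprocal-inverse : ∀ f f₀#0 n → (f ⊛ reciprocal f f₀#0) n ≈ constant 1# n
  reciprocal-inverse f f₀#0 zero    =
    trans (+-identityʳ _) (⁻¹-inverseʳ (nonZero (f 0) f₀#0))
  reciprocal-inverse f f₀#0 (suc n) = begin
    f 0 * - (b₀ * S) + ∑[ i ≤ n ] (f (suc (toℕ i)) * reciprocal f f₀#0 (n ∸ toℕ i))
      ≈⟨ +-cong (sym (-‿distribʳ-* (f 0) (b₀ * S)))
           (reflexive (sum-cong-≗ {suc n} λ i → ≡.cong (f (suc (toℕ i)) *_) (≡.sym (reciprocals-lookup f f₀#0 n i)))) ⟩
    - (f 0 * (b₀ * S)) + S
      ≈⟨ +-congʳ (-‿cong (trans (sym (*-assoc (f 0) b₀ S))
           (trans (*-congʳ (⁻¹-inverseʳ (nonZero (f 0) f₀#0))) (*-identityˡ S)))) ⟩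
    - S + S
      ≈⟨ -‿inverseˡ S ⟩
    0# ∎
    where
    open SetoidReasoning setoid
    b₀ = nonZero (f 0) f₀#0 ⁻¹
    S  = ∑[ i ≤ n ] (f (suc (toℕ i)) * reciprocals f f₀#0 n i)

  -- n ↦ aₙ, where f = ∑ aₙ tⁿ/n!.
  egfCoefficient : PowerSeries → ℕ → Carrier
  egfCoefficient f n = fromℕ (n !) * f n

  -- (z)_{n,ƛ} = z (z − ƛ) (z − 2ƛ) ⋯ (z − (n−1)ƛ)
  ⟪_⟫[_,_] : Carrier → ℕ → Carrier → Carrier
  ⟪ z ⟫[ zero  , ƛ ] = 1#
  ⟪ z ⟫[ suc n , ƛ ] = ⟪ z ⟫[ n , ƛ ] * (z - fromℕ n * ƛ)

  -- e_ƛ^z(t) = (1 + ƛt)^{z/ƛ}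
  exp[_]^_ : Carrier → Carrier → PowerSeries
  (exp[ ƛ ]^ z) n = ⟪ z ⟫[ n , ƛ ] / factorial n

  -- (1 + t)ᵃ = ∑ a (a − 1) ⋯ (a − n + 1) tⁿ/n!
  binomialSeries : Carrier → PowerSeries
  binomialSeries a n = ⟪ a ⟫[ n , 1# ] / factorial n

  -- log_ƛ(1 + t) = ƛ⁻¹ ((1 + t)^ƛ − 1)
  logSeries : Kˣ → PowerSeries
  logSeries ƛ = (ƛ ⁻¹) • (binomialSeries (value ƛ) ⊖ constant 1#)

  private
    1/0! : 1# / factorial 0 ≈ 1#
    1/0! = trans (*-congʳ (sym (+-identityʳ 1#))) (⁻¹-inverseʳ (factorial 0))

  logSeries₀ : ∀ ƛ → logSeries ƛ 0 ≈ 0#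
  logSeries₀ ƛ = trans (*-congˡ (trans (+-congʳ 1/0!) (-‿inverseʳ 1#))) (zeroʳ (ƛ ⁻¹))

  -- (log_ƛ(1 + t))ʲ/j! = ∑ S₁(n,j) tⁿ/n!
  S₁ : Kˣ → ℕ → ℕ → Carrier
  S₁ ƛ n j = egfCoefficient ((factorial j ⁻¹) • (logSeries ƛ ^ᴾ j)) n

  -- ∑_{n ≥ 1} (1)_{n,ƛ} tⁿ / (nᵏ (n−1)!)
  Ei : ℤ → Carrier → PowerSeries
  Ei k ƛ zero    = 0#
  Ei k ƛ (suc n) = ⟪ 1# ⟫[ suc n , ƛ ] / (fromℕˣ (suc n) ^ℤ k *ˣ factorial n)

  -- e_ƛ(t) − u
  denominator : Carrier → Carrier → PowerSeries
  denominator ƛ u = (exp[ ƛ ]^ 1#) ⊖ constant u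

  denominator₀#0 : ∀ ƛ u → u # 1# → denominator ƛ u 0 # 0#
  denominator₀#0 ƛ u u#1 = #-congʳ (+-congʳ (sym 1/0!)) (-#0 (#-sym u#1))
    where
    -#0 : ∀ {x y} → x # y → x - y # 0#
    -#0 {x} {y} x#y with v , vl , _ ← #⇒invertible x#y =
      invertibleˡ⇒# (v , trans (*-congˡ (x-0≈x (x - y))) vl)

  FG : (ƛ u : Carrier) → u # 1# → (x : Carrier) → ℕ → Carrier
  FG ƛ u u#1 x = egfCoefficient
    (((1# - u) • reciprocal (denominator ƛ u) (denominator₀#0 ƛ u u#1)) ⊛ (exp[ ƛ ]^ x))

  polyFG : (k : ℤ) (ƛ : Kˣ) (u : Carrier) → u # 1# → (x : Carrier) → ℕ → Carrier
  polyFG k ƛ u u#1 x = egfCoefficient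
    (((1# - u) • substitute (Ei k (value ƛ)) (logSeries ƛ) (logSeries₀ ƛ))
      ⊛ reciprocal (denominator (value ƛ) u) (denominator₀#0 (value ƛ) u u#1)
      ⊛ (exp[ value ƛ ]^ x))

open Real public using (ℝ; 0ᴿ) renaming (_#_ to _#ᴿ_)

private
  module ℝ[i] = AdjoinI Real.heytingField Real.sum-of-squares#0

-- Opaque so that conversion checking does not unfold terms over ℂ down to
-- sequences of rationals; `unfolding` exposes the pairs of reals.
opaque
  ℂ-heytingField : HeytingField 0ℓ 0ℓ 0ℓ
  ℂ-heytingField = ℝ[i].heytingFieldᶜ

  ℂ-characteristicZero : CharacteristicZero ℂ-heytingField
  ℂ-characteristicZero = ℝ[i].characteristicZeroᶜ Real.characteristicZero

open HeytingField ℂ-heytingField public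
  using (_≈_; _#_; _+_; _*_; _-_; -_; 0#; 1#) renaming (Carrier to ℂ)

open Degenerate ℂ-heytingField ℂ-characteristicZero public renaming (Kˣ to ℂˣ)

opaque
  unfolding ℂ-heytingField

  ofReal : ℝ → ℂ
  ofReal = ℝ[i].ofReal

  ofReal#0 : ∀ {a} → a #ᴿ 0ᴿ → ofReal a # 0#
  ofReal#0 = inj₁

ofRealˣ : (a : ℝ) → a #ᴿ 0ᴿ → ℂˣ
ofRealˣ a a#0 = nonZero (ofReal a) (ofReal#0 a#0)

{-# OPTIONS --safe #-}
-- Put G(t) = (1 − u) e_ƛ^x(t) / (e_ƛ(t) − u) and H(t) = Ei_{k,ƛ}(log_ƛ(1 + t)), so that the
-- generating function of FG^{(k)} is H G.  The definition of S₁ gives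
-- H = ∑_{m ≥ 1} (∑_{1 ≤ j ≤ m} (1)_{j,ƛ} j^{1−k} S₁(m,j)) tᵐ/m!.  Since H has no constant term,
-- the binomial convolution for the coefficient of tⁿ/n! in H G starts at m = 1, and
-- n! / ((m+1)! (n−1−m)!) = n (n−1 choose m) / (m+1).
module Submission where

open import Data.Nat.Base as ℕ using (ℕ; zero; suc; _∸_; _!)
open import Data.Nat.Combinatorics using (_C_; nCk≡n!/k![n-k]!; k![n∸k]!∣n!)
open import Data.Nat.DivMod using (m*[n/m]≡n)
import Data.Nat.Properties as ℕ
open import Data.Integer.Base as ℤ using (ℤ; 1ℤ; +_; -[1+_])
open import Data.Fin.Base using (Fin; toℕ)
open import Data.Fin.Properties using (toℕ≤pred[n])
open import Algebra.Apartness.Bundles using (HeytingField)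
open import Algebra.Bundles using (CommutativeRing)
import Algebra.Properties.Semiring.Mult as SemiringMult
import Algebra.Properties.Semiring.Sum as SemiringSum
import Relation.Binary.PropositionalEquality as ≡
import Relation.Binary.Reasoning.Setoid as SetoidReasoning
open import Defs using (CharacteristicZero; fieldRing; module Degenerate)

-- Binomial coefficients and factorials in ℕ.

[nCk*k!]*[n∸k]!≡n! : ∀ {n k} → k ℕ.≤ n → ((n C k) ℕ.* k !) ℕ.* (n ∸ k) ! ≡.≡ n !
[nCk*k!]*[n∸k]!≡n! {n} {k} k≤n = begin
  ((n C k) ℕ.* k !) ℕ.* (n ∸ k) !   ≡⟨ ℕ.*-assoc (n C k) (k !) ((n ∸ k) !) ⟩
  (n C k) ℕ.* d                     ≡⟨ ℕ.*-comm (n C k) d ⟩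
  d ℕ.* (n C k)                     ≡⟨ ≡.cong (d ℕ.*_) (nCk≡n!/k![n-k]! k≤n) ⟩
  -- The quotient is exact because `d` divides `n !`, so multiplying by `d` undoes it.
  d ℕ.* (n ! ℕ./ d)                 ≡⟨ m*[n/m]≡n (k![n∸k]!∣n! k≤n) ⟩
  n !                               ∎
  where
  open ≡.≡-Reasoning
  d = k ! ℕ.* (n ∸ k) !
  instance
    d≢0 : ℕ.NonZero d
    d≢0 = k ℕ.!* (n ∸ k) !≢0

module DegenerateProperties {c ℓ₁ ℓ₂} (K : HeytingField c ℓ₁ ℓ₂) (charZero : CharacteristicZero K) where

  open HeytingField K
  open Degenerate K charZero
  open CommutativeRing (fieldRing K) using (semiring; commutativeSemiring)
  open SemiringSum semiring using (sum-cong-≋; *-distribˡ-sum; *-distribʳ-sum)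
  open SemiringMult semiring using (×1-homo-*)
  open SetoidReasoning setoid
  open import Algebra.Solver.Ring.NaturalCoefficients.Default commutativeSemiring
    using (solve; con; _:=_; _:+_; _:*_)

  -- Naturals, inverses and integer powers in a field of characteristic zero.

  fromℕ-homo-* : ∀ m n → fromℕ (m ℕ.* n) ≈ fromℕ m * fromℕ n
  fromℕ-homo-* = ×1-homo-*

  -- `fromℕˣ` computes only on a successor, and `n !` does not reduce to one for variable `n`.
  value-fromℕˣ : ∀ n .{{_ : ℕ.NonZero n}} → value (fromℕˣ n) ≡.≡ fromℕ n
  value-fromℕˣ (suc n) = ≡.refl

  value-factorial : ∀ n → value (factorial n) ≈ fromℕ (n !)
  value-factorial n = reflexive (value-fromℕˣ (n !) {{n ℕ.!≢0}})

  fromℕ-suc! : ∀ n → fromℕ (suc n !) ≈ fromℕ (suc n) * fromℕ (n !)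
  fromℕ-suc! n = fromℕ-homo-* (suc n) (n !)

  ⁻¹-unique : ∀ x {y} → y * value x ≈ 1# → y ≈ x ⁻¹
  ⁻¹-unique x {y} yx≈1 = begin
    y                     ≈⟨ *-identityʳ y ⟨
    y * 1#                ≈⟨ *-congˡ (⁻¹-inverseʳ x) ⟨
    y * (value x * x ⁻¹)  ≈⟨ *-assoc y (value x) (x ⁻¹) ⟨
    y * value x * x ⁻¹    ≈⟨ *-congʳ yx≈1 ⟩
    1# * x ⁻¹             ≈⟨ *-identityˡ (x ⁻¹) ⟩
    x ⁻¹                  ∎

  -- `x ⁻¹` is extracted from the apartness proof stored in `x`, so equal values alone do not give
  -- this by computation; uniqueness of inverses does.
  ⁻¹-cong : ∀ x y → value x ≈ value y → x ⁻¹ ≈ y ⁻¹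
  ⁻¹-cong x y x≈y = ⁻¹-unique y (trans (*-congˡ (sym x≈y)) (⁻¹-inverseˡ x))

  ⁻¹-*ˣ : ∀ x y → (x *ˣ y) ⁻¹ ≈ x ⁻¹ * y ⁻¹
  ⁻¹-*ˣ x y = sym (⁻¹-unique (x *ˣ y) (begin
    x ⁻¹ * y ⁻¹ * (value x * value y)
      ≈⟨ solve 4 (λ a b c d → a :* b :* (c :* d) := a :* c :* (b :* d)) refl (x ⁻¹) (y ⁻¹) (value x) (value y) ⟩
    x ⁻¹ * value x * (y ⁻¹ * value y)
      ≈⟨ *-cong (⁻¹-inverseˡ x) (⁻¹-inverseˡ y) ⟩
    1# * 1#
      ≈⟨ *-identityˡ 1# ⟩
    1# ∎))

  ^ℤ-suc : ∀ x k → value (x ^ℤ k) ≈ value x * value (x ^ℤ (k ℤ.- 1ℤ))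
  ^ℤ-suc x (+ zero)  = sym (trans (*-congˡ (*-identityʳ (x ⁻¹))) (⁻¹-inverseʳ x))
  ^ℤ-suc x (+ suc n) = refl
  -- The exponent `-[1+ n ] - 1ℤ` computes to `-[1+ suc (n + 0) ]`. Its power has one more factor
  -- `x ⁻¹`, which `value x` cancels.
  ^ℤ-suc x -[1+ n ] rewrite ℕ.+-identityʳ n = begin
    y                       ≈⟨ *-identityˡ y ⟨
    1# * y                  ≈⟨ *-congʳ (⁻¹-inverseʳ x) ⟨
    value x * x ⁻¹ * y      ≈⟨ *-assoc (value x) (x ⁻¹) y ⟩
    value x * (x ⁻¹ * y)    ∎
    where y = value (invˣ x ^ˣ suc n)

  -- Algebra of the Cauchy product.

  infix 4 _≋_
  _≋_ : PowerSeries → PowerSeries → Set ℓ₁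
  f ≋ g = ∀ n → f n ≈ g n

  -- Makes induction on the degree possible: `(f ⊛ g) (suc n)` is by computation
  -- `f 0 * g (suc n) + (shift f ⊛ g) n`.
  shift : PowerSeries → PowerSeries
  shift f n = f (suc n)

  ⊛-congʳ : ∀ {f f′} g → f ≋ f′ → f ⊛ g ≋ f′ ⊛ g
  ⊛-congʳ g f≋f′ n = sum-cong-≋ {suc n} λ i → *-congʳ {g (n ∸ toℕ i)} (f≋f′ (toℕ i))

  ⊛-distribʳ : ∀ f g h n → ((λ i → f i + g i) ⊛ h) n ≈ (f ⊛ h) n + (g ⊛ h) n
  ⊛-distribʳ f g h zero    =
    solve 3 (λ a b c → (a :+ b) :* c :+ con 0 := (a :* c :+ con 0) :+ (b :* c :+ con 0)) refl (f 0) (g 0) (h 0)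
  ⊛-distribʳ f g h (suc n) = begin
    (f 0 + g 0) * h (suc n) + ((λ i → shift f i + shift g i) ⊛ h) n
      ≈⟨ +-congˡ (⊛-distribʳ (shift f) (shift g) h n) ⟩
    (f 0 + g 0) * h (suc n) + ((shift f ⊛ h) n + (shift g ⊛ h) n)
      ≈⟨ solve 5 (λ a b c d e → (a :+ b) :* c :+ (d :+ e) := (a :* c :+ d) :+ (b :* c :+ e)) refl
           (f 0) (g 0) (h (suc n)) ((shift f ⊛ h) n) ((shift g ⊛ h) n) ⟩
    (f ⊛ h) (suc n) + (g ⊛ h) (suc n) ∎

  •-⊛-assoc : ∀ a f g → (a • f) ⊛ g ≋ a • (f ⊛ g)
  •-⊛-assoc a f g n = begin
    ((a • f) ⊛ g) n
      ≈⟨ sum-cong-≋ {suc n} (λ i → *-assoc a (f (toℕ i)) (g (n ∸ toℕ i))) ⟩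
    ∑[ i ≤ n ] (a * (f (toℕ i) * g (n ∸ toℕ i)))
      ≈⟨ *-distribˡ-sum {suc n} a (λ i → f (toℕ i) * g (n ∸ toℕ i)) ⟨
    (a • (f ⊛ g)) n ∎

  ⊛-•-comm : ∀ a f g → (a • f) ⊛ g ≋ f ⊛ (a • g)
  ⊛-•-comm a f g n = sum-cong-≋ {suc n} λ i →
    solve 3 (λ a b c → a :* b :* c := b :* (a :* c)) refl a (f (toℕ i)) (g (n ∸ toℕ i))

  -- Induction on the degree, for all `f` at once: `shift (f ⊛ g)` is `f 0 • shift g` plus
  -- `shift f ⊛ g`. Distributivity separates the two, and the induction hypothesis for `shift f`
  -- handles the second.
  ⊛-assoc : ∀ f g h → (f ⊛ g) ⊛ h ≋ f ⊛ (g ⊛ h)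
  ⊛-assoc f g h zero    = begin
    (f 0 * g 0 + 0#) * h 0 + 0#   ≈⟨ +-congʳ (trans (*-congʳ (+-identityʳ _)) (*-assoc _ _ _)) ⟩
    f 0 * (g 0 * h 0) + 0#        ≈⟨ +-congʳ (*-congˡ (+-identityʳ _)) ⟨
    f 0 * (g 0 * h 0 + 0#) + 0#   ∎
  ⊛-assoc f g h (suc n) = begin
    (f 0 * g 0 + 0#) * h (suc n) + ((λ i → (f 0 • shift g) i + (shift f ⊛ g) i) ⊛ h) n
      ≈⟨ +-cong (*-congʳ (+-identityʳ _)) (⊛-distribʳ (f 0 • shift g) (shift f ⊛ g) h n) ⟩
    f 0 * g 0 * h (suc n) + (((f 0 • shift g) ⊛ h) n + ((shift f ⊛ g) ⊛ h) n)
      ≈⟨ +-congˡ (+-cong (•-⊛-assoc (f 0) (shift g) h n) (⊛-assoc (shift f) g h n)) ⟩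
    f 0 * g 0 * h (suc n) + (f 0 * (shift g ⊛ h) n + (shift f ⊛ (g ⊛ h)) n)
      ≈⟨ solve 5 (λ a b c d e → a :* b :* c :+ (a :* d :+ e) := a :* (b :* c :+ d) :+ e) refl
           (f 0) (g 0) (h (suc n)) ((shift g ⊛ h) n) ((shift f ⊛ (g ⊛ h)) n) ⟩
    (f ⊛ (g ⊛ h)) (suc n) ∎

  -- Binomial convolution of exponential generating functions.

  -- The last two factors are the factorials that turn the coefficients of index `suc m` and `n ∸ m`
  -- into egf coefficients.
  suc!-split : ∀ {n m} → m ℕ.≤ n → fromℕ (suc n !) ≈
    fromℕ (suc n) * (fromℕ (n C m) / fromℕˣ (suc m)) * (fromℕ (suc m !) * fromℕ ((n ∸ m) !))
  suc!-split {n} {m} m≤n = begin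
    fromℕ (suc n !)
      ≈⟨ fromℕ-suc! n ⟩
    N * fromℕ (n !)
      ≈⟨ *-congˡ (reflexive (≡.cong fromℕ (≡.sym ([nCk*k!]*[n∸k]!≡n! m≤n)))) ⟩
    N * fromℕ ((n C m) ℕ.* m ! ℕ.* (n ∸ m) !)
      ≈⟨ *-congˡ (trans (fromℕ-homo-* ((n C m) ℕ.* m !) ((n ∸ m) !)) (*-congʳ (fromℕ-homo-* (n C m) (m !)))) ⟩
    N * (B * M! * R)
      -- Of the inserted `M⁻¹ * M`, the first factor becomes the denominator of the binomial
      -- coefficient and the second raises `m !` to `suc m !`.
      ≈⟨ *-congˡ (*-congʳ (*-congʳ (trans (sym (*-identityʳ B)) (*-congˡ (sym (⁻¹-inverseˡ (fromℕˣ (suc m)))))))) ⟩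
    N * (B * (M⁻¹ * M) * M! * R)
      ≈⟨ solve 6 (λ N B M⁻¹ M M! R → N :* (B :* (M⁻¹ :* M) :* M! :* R) := N :* (B :* M⁻¹) :* (M :* M! :* R)) refl
           N B M⁻¹ M M! R ⟩
    N * (B * M⁻¹) * (M * M! * R)
      ≈⟨ *-congˡ (*-congʳ (sym (fromℕ-suc! m))) ⟩
    N * (B * M⁻¹) * (fromℕ (suc m !) * R) ∎
    where
    N   = fromℕ (suc n)
    B   = fromℕ (n C m)
    M   = fromℕ (suc m)
    M⁻¹ = fromℕˣ (suc m) ⁻¹
    M!  = fromℕ (m !)
    R   = fromℕ ((n ∸ m) !)

  -- Since `f 0` vanishes, the Cauchy product loses its first term, and index `m` stands for the
  -- coefficient of `f` at `suc m`.
  egfCoefficient-⊛ : ∀ f g → f 0 ≈ 0# → ∀ n →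
    egfCoefficient (f ⊛ g) n ≈ fromℕ n * ∑[ m < n ] (
      (fromℕ ((n ∸ 1) C toℕ m) / fromℕˣ (suc (toℕ m)))
      * (egfCoefficient f (suc (toℕ m)) * egfCoefficient g (n ∸ 1 ∸ toℕ m)))
  egfCoefficient-⊛ f g f₀≈0 zero    = begin
    fromℕ 1 * (f 0 * g 0 + 0#)   ≈⟨ *-congˡ (trans (+-identityʳ _) (trans (*-congʳ f₀≈0) (zeroˡ (g 0)))) ⟩
    fromℕ 1 * 0#                 ≈⟨ zeroʳ _ ⟩
    -- In degree zero the right-hand side is `fromℕ 0` times an empty sum.
    0#                           ≈⟨ zeroʳ 0# ⟨
    0# * 0#                      ∎
  egfCoefficient-⊛ f g f₀≈0 (suc n) = begin
    fromℕ (suc n !) * (f 0 * g (suc n) + (shift f ⊛ g) n)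
      ≈⟨ *-congˡ (trans (+-congʳ (trans (*-congʳ f₀≈0) (zeroˡ _))) (+-identityˡ _)) ⟩
    fromℕ (suc n !) * (shift f ⊛ g) n
      ≈⟨ *-distribˡ-sum {suc n} (fromℕ (suc n !)) (λ m → f (suc (toℕ m)) * g (n ∸ toℕ m)) ⟩
    ∑[ m ≤ n ] (fromℕ (suc n !) * (f (suc (toℕ m)) * g (n ∸ toℕ m)))
      ≈⟨ sum-cong-≋ {suc n} term ⟩
    ∑[ m ≤ n ] (fromℕ (suc n) * (a m * b m))
      ≈⟨ *-distribˡ-sum {suc n} (fromℕ (suc n)) (λ m → a m * b m) ⟨
    fromℕ (suc n) * ∑[ m ≤ n ] (a m * b m) ∎
    where
    a b : Fin (suc n) → Carrier
    a m = fromℕ (n C toℕ m) / fromℕˣ (suc (toℕ m))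
    b m = egfCoefficient f (suc (toℕ m)) * egfCoefficient g (n ∸ toℕ m)
    term : ∀ m → fromℕ (suc n !) * (f (suc (toℕ m)) * g (n ∸ toℕ m)) ≈ fromℕ (suc n) * (a m * b m)
    term m = trans (*-congʳ (suc!-split (toℕ≤pred[n] m)))
      (solve 6 (λ N A P R F G → N :* A :* (P :* R) :* (F :* G) := N :* (A :* (P :* F :* (R :* G)))) refl
        (fromℕ (suc n)) (a m) (fromℕ (suc (toℕ m) !)) (fromℕ ((n ∸ toℕ m) !)) (f (suc (toℕ m))) (g (n ∸ toℕ m)))

  -- Coefficients of the polyexponential composed with the logarithm.

  -- With n = j + 1, nᵏ (n-1)! = nᵏ⁻¹ n!. This splits off the factor 1/n! that the definition of
  -- `S₁` contains.
  Ei-suc : ∀ k ƛ j → Ei k ƛ (suc j) ≈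
    (⟪ 1# ⟫[ suc j , ƛ ] / (fromℕˣ (suc j) ^ℤ (k ℤ.- 1ℤ))) * factorial (suc j) ⁻¹
  Ei-suc k ƛ j = begin
    A * (x ^ℤ k *ˣ factorial j) ⁻¹
      ≈⟨ *-congˡ (⁻¹-cong (x ^ℤ k *ˣ factorial j) (y *ˣ factorial (suc j)) same) ⟩
    A * (y *ˣ factorial (suc j)) ⁻¹
      ≈⟨ *-congˡ (⁻¹-*ˣ y (factorial (suc j))) ⟩
    A * (y ⁻¹ * factorial (suc j) ⁻¹)
      ≈⟨ *-assoc A (y ⁻¹) (factorial (suc j) ⁻¹) ⟨
    A * y ⁻¹ * factorial (suc j) ⁻¹ ∎
    where
    A = ⟪ 1# ⟫[ suc j , ƛ ]
    x = fromℕˣ (suc j)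
    y = x ^ℤ (k ℤ.- 1ℤ)
    same : value (x ^ℤ k) * value (factorial j) ≈ value y * value (factorial (suc j))
    same = begin
      value (x ^ℤ k) * value (factorial j)  ≈⟨ *-cong (^ℤ-suc x k) (value-factorial j) ⟩
      value x * value y * fromℕ (j !)       ≈⟨ *-congʳ (*-comm (value x) (value y)) ⟩
      value y * value x * fromℕ (j !)       ≈⟨ *-assoc (value y) (value x) (fromℕ (j !)) ⟩
      value y * (value x * fromℕ (j !))     ≈⟨ *-congˡ (fromℕ-suc! j) ⟨
      value y * fromℕ (suc j !)             ≈⟨ *-congˡ (value-factorial (suc j)) ⟨
      value y * value (factorial (suc j))   ∎

  Ei∘log : ℤ → Kˣ → PowerSeries
  Ei∘log k ƛ = substitute (Ei k (value ƛ)) (logSeries ƛ) (logSeries₀ ƛ)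

  Ei∘log₀ : ∀ k ƛ → Ei∘log k ƛ 0 ≈ 0#
  Ei∘log₀ k ƛ = trans (+-identityʳ _) (zeroˡ _)

  -- The term of index 0 drops out because `Ei` has no constant term. In the others, the outer
  -- factorial, the 1/j! from `Ei-suc` and the power of the logarithm make up `S₁`.
  egfCoefficient-Ei∘log : ∀ k ƛ m → egfCoefficient (Ei∘log k ƛ) (suc m) ≈
    ∑[ j < suc m ] (
      (⟪ 1# ⟫[ suc (toℕ j) , value ƛ ] / (fromℕˣ (suc (toℕ j)) ^ℤ (k ℤ.- 1ℤ)))
      * S₁ ƛ (suc m) (suc (toℕ j)))
  egfCoefficient-Ei∘log k ƛ m = begin
    M! * (0# * L 0 + ∑[ j < suc m ] (E j * L (suc (toℕ j))))
      ≈⟨ *-congˡ (trans (+-congʳ (zeroˡ (L 0))) (+-identityˡ _)) ⟩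
    M! * ∑[ j < suc m ] (E j * L (suc (toℕ j)))
      ≈⟨ *-distribˡ-sum {suc m} M! (λ j → E j * L (suc (toℕ j))) ⟩
    ∑[ j < suc m ] (M! * (E j * L (suc (toℕ j))))
      ≈⟨ sum-cong-≋ {suc m} (λ j → trans (*-congˡ (*-congʳ (Ei-suc k (value ƛ) (toℕ j))))
           (solve 4 (λ M A J L → M :* (A :* J :* L) := A :* (M :* (J :* L))) refl
             M! (c′ j) (factorial (suc (toℕ j)) ⁻¹) (L (suc (toℕ j))))) ⟩
    ∑[ j < suc m ] (c′ j * S₁ ƛ (suc m) (suc (toℕ j))) ∎
    where
    M! = fromℕ (suc m !)
    L : ℕ → Carrier
    L j = (logSeries ƛ ^ᴾ j) (suc m)
    E c′ : Fin (suc m) → Carrier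
    E j = Ei k (value ƛ) (suc (toℕ j))
    c′ j = ⟪ 1# ⟫[ suc (toℕ j) , value ƛ ] / (fromℕˣ (suc (toℕ j)) ^ℤ (k ℤ.- 1ℤ))

  -- The formula over a general field, then over ℂ.

  polyFG-formula : ∀ k ƛ u u#1 x n →
    polyFG k ƛ u u#1 x n
      ≈ fromℕ n * ∑[ m < n ] (
          (fromℕ ((n ∸ 1) C toℕ m) / fromℕˣ (suc (toℕ m)))
          * ∑[ j < suc (toℕ m) ] (
              (⟪ 1# ⟫[ suc (toℕ j) , value ƛ ] / (fromℕˣ (suc (toℕ j)) ^ℤ (k ℤ.- 1ℤ)))
              * S₁ ƛ (suc (toℕ m)) (suc (toℕ j))
              * FG (value ƛ) u u#1 x (n ∸ 1 ∸ toℕ m)))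
  polyFG-formula k ƛ u u#1 x n = begin
    polyFG k ƛ u u#1 x n
      -- The scalar 1 - u moves from `H` to `R`, so that after reassociation the right factor `G` is
      -- literally the series defining `FG`.
      ≈⟨ *-congˡ (trans (⊛-congʳ e^x (⊛-•-comm (1# - u) H R) n) (⊛-assoc H ((1# - u) • R) e^x n)) ⟩
    egfCoefficient (H ⊛ G) n
      ≈⟨ egfCoefficient-⊛ H G (Ei∘log₀ k ƛ) n ⟩
    fromℕ n * ∑[ m < n ] (a m * (egfCoefficient H (suc (toℕ m)) * egfCoefficient G (n ∸ 1 ∸ toℕ m)))
      ≈⟨ *-congˡ (sum-cong-≋ {n} λ m → *-congˡ {a m} (trans
           (*-congʳ (egfCoefficient-Ei∘log k ƛ (toℕ m)))
           -- The `FG` factor does not depend on `j` and is carried into the inner sum.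
           (*-distribʳ-sum {suc (toℕ m)} (egfCoefficient G (n ∸ 1 ∸ toℕ m)) (b (toℕ m))))) ⟩
    fromℕ n * ∑[ m < n ] (a m * ∑[ j < suc (toℕ m) ] (b (toℕ m) j * egfCoefficient G (n ∸ 1 ∸ toℕ m))) ∎
    where
    H R e^x G : PowerSeries
    H   = Ei∘log k ƛ
    R   = reciprocal (denominator (value ƛ) u) (denominator₀#0 (value ƛ) u u#1)
    e^x = exp[ value ƛ ]^ x
    G   = ((1# - u) • R) ⊛ e^x
    a : Fin n → Carrier
    a m = fromℕ ((n ∸ 1) C toℕ m) / fromℕˣ (suc (toℕ m))
    b : ∀ m → Fin (suc m) → Carrier
    b m j = (⟪ 1# ⟫[ suc (toℕ j) , value ƛ ] / (fromℕˣ (suc (toℕ j)) ^ℤ (k ℤ.- 1ℤ)))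
      * S₁ ƛ (suc m) (suc (toℕ j))

open import Defs

theorem1 : (ƛ : ℝ) (ƛ#0 : ƛ #ᴿ 0ᴿ) (k : ℤ) (u : ℂ) (u#1 : u # 1#) (x : ℝ) (n : ℕ) →
    polyFG k (ofRealˣ ƛ ƛ#0) u u#1 (ofReal x) n
    ≈ fromℕ n * ∑[ m < n ] (
    (fromℕ ((n ∸ 1) C toℕ m) / fromℕˣ (suc (toℕ m)))
    * ∑[ j < suc (toℕ m) ] (
    (⟪ 1# ⟫[ suc (toℕ j) , ofReal ƛ ] / (fromℕˣ (suc (toℕ j)) ^ℤ (k ℤ.- 1ℤ)))
    * S₁ (ofRealˣ ƛ ƛ#0) (suc (toℕ m)) (suc (toℕ j))
    * FG (ofReal ƛ) u u#1 (ofReal x) (n ∸ 1 ∸ toℕ m)))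
theorem1 ƛ ƛ#0 k u u#1 x n =
  -- `value (ofRealˣ ƛ ƛ#0)` reduces to `ofReal ƛ`, so the general formula has the required type.
  DegenerateProperties.polyFG-formula ℂ-heytingField ℂ-characteristicZero k (ofRealˣ ƛ ƛ#0) u u#1 (ofReal x) n
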